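{- Let $A$ be a nonrecursive c.e. $D$-maximal set of Type 1, 2, or 3. Then the many-one degree of $A$ contains a least finite-one degree, i.e. there is $C\equiv_{\rm m}A$ with $C\le_{\rm fo}B$ for every $B\equiv_{\rm m}A$.
   Context: All sets are subsets of $\omega$; $X\subseteq^* Y$ means $X\setminus Y$ is finite. $A\le_{\rm m}B$: there is total computable $f$ with $x\in A\iff f(x)\in B$; $\equiv_{\rm m}$ is mutual $\le_{\rm m}$. $A\le_{\rm fo}B$: there is total computable $g$ with $x\in A\iff g(x)\in B$ and every fibre $g^{ -1}(\{y\})$ finite. A noncomputable c.e. set $A$ is $D$-maximal if for every c.e. $W\supseteq A$, either $W\setminus A$ is c.e. or there is a computable $R$ with $A\subseteq R\subseteq W$. For a c.e. set $A$, $\mathcal D(A)$ is the family of all c.e. sets disjoint from $A$; a finite or countable family $\{G_i:i\in I\}$ of c.e. sets disjoint from $A$ generates $\mathcal D(A)$ if every c.e. set $D$ disjoint from $A$ satisfies $D\subseteq^*\bigcup_{i\in F}G_i$ for some finite $F\subseteq I$. A generating family is of Type 1 if it is $\{\varnothing\}$; of Type 2 if it is $\{R\}$ with $R$ an infinite computable set; of Type 3 if it is $\{W\}$ with $W$ an infinite noncomputable c.e. set. A c.e. set $A$ is of Type $n$ if $\mathcal D(A)$ has a generating family of Type $n$ and no generating family of Type $m$ for any $m<n$. -}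

module Defs where

open import Level using (0ℓ)
open import Data.Nat using (ℕ; zero; suc; _<_; _≤_)
open import Data.Fin using (Fin)
open import Data.Vec using (Vec; []; _∷_; lookup)
open import Data.Maybe using (Maybe; just; nothing; _>>=_)
open import Data.Product using (Σ; ∃; _×_; _,_)
open import Data.Sum using (_⊎_)
open import Data.Unit using (⊤)
open import Data.Empty using (⊥)
open import Data.List using (List)
open import Data.List.Membership.Propositional using (_∈_)
open import Relation.Nullary using (¬_)
open import Relation.Binary.PropositionalEquality using (_≡_)
open import Function.Bundles using (_⇔_)

data Code : ℕ → Set where
  zer  : ∀ {n} → Code n
  succ : Code 1
  proj : ∀ {n} → Fin n → Code n
  comp : ∀ {m n} → Code m → Vec (Code n) m → Code n
  prec : ∀ {n} → Code n → Code (suc (suc n)) → Code (suc n)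
  mu   : ∀ {n} → Code (suc n) → Code n

mutual
  eval : ∀ {n} → ℕ → Code n → Vec ℕ n → Maybe ℕ
  eval zero    _          _             = nothing
  eval (suc f) zer        v             = just 0
  eval (suc f) succ       (x ∷ [])      = just (suc x)
  eval (suc f) (proj i)   v             = just (lookup v i)
  eval (suc f) (comp g hs) v            = evalVec f hs v >>= λ w → eval f g w
  eval (suc f) (prec g h) (x ∷ v)       = evalPrec f g h x v
  eval (suc f) (mu g)     v             = evalMu f g v 0

  evalVec : ∀ {m n} → ℕ → Vec (Code n) m → Vec ℕ n → Maybe (Vec ℕ m)
  evalVec f []       v = just []
  evalVec f (h ∷ hs) v =
    eval f h v >>= λ y → evalVec f hs v >>= λ ys → just (y ∷ ys)

  evalPrec : ∀ {n} → ℕ → Code n → Code (suc (suc n)) → ℕ → Vec ℕ n → Maybe ℕ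
  evalPrec f g h zero    v = eval f g v
  evalPrec f g h (suc x) v = evalPrec f g h x v >>= λ r → eval f h (x ∷ r ∷ v)

  evalMu : ∀ {n} → ℕ → Code (suc n) → Vec ℕ n → ℕ → Maybe ℕ
  evalMu zero    g v k = nothing
  evalMu (suc f) g v k = eval f g (k ∷ v) >>= λ where
    zero    → just k
    (suc _) → evalMu f g v (suc k)

Set' : Set₁
Set' = ℕ → Set

_⊆_ : Set' → Set' → Set
X ⊆ Y = ∀ x → X x → Y x

_⊆*_ : Set' → Set' → Set
X ⊆* Y = ∃ λ n → ∀ x → n ≤ x → X x → Y x

_∖_ : Set' → Set' → Set'
(X ∖ Y) x = X x × ¬ Y x

∅ : Set'
∅ _ = ⊥

Finite : Set' → Set
Finite X = ∃ λ n → ∀ x → X x → x < n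

Infinite : Set' → Set
Infinite X = ¬ Finite X

Disjoint : Set' → Set' → Set
Disjoint X Y = ∀ x → X x → Y x → ⊥

ComputableFn : (ℕ → ℕ) → Set
ComputableFn g = ∃ λ (c : Code 1) → ∀ x → ∃ λ f → eval f c (x ∷ []) ≡ just (g x)

Computable : Set' → Set
Computable R = ∃ λ χ → ComputableFn χ × (∀ x → R x ⇔ (χ x ≡ 0))

CE : Set' → Set
CE W = ∃ λ (c : Code 1) → ∀ x → W x ⇔ (∃ λ f → ∃ λ y → eval f c (x ∷ []) ≡ just y)

_≤m_ : Set' → Set' → Set
A ≤m B = ∃ λ f → ComputableFn f × (∀ x → A x ⇔ B (f x))

_≡m_ : Set' → Set' → Set
A ≡m B = (A ≤m B) × (B ≤m A)

_≤fo_ : Set' → Set' → Set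
A ≤fo B = ∃ λ g → ComputableFn g × (∀ x → A x ⇔ B (g x))
                 × (∀ y → Finite (λ x → g x ≡ y))

DMaximal : Set' → Set₁
DMaximal A = CE A × ¬ Computable A ×
  (∀ W → CE W → A ⊆ W →
     CE (W ∖ A) ⊎ (∃ λ R → Computable R × A ⊆ R × R ⊆ W))

Generates : {I : Set} → (I → Set') → Set' → Set₁
Generates {I} G A =
  (∀ i → CE (G i) × Disjoint (G i) A) ×
  (∀ D → CE D → Disjoint D A →
     ∃ λ (F : List I) → D ⊆* (λ x → ∃ λ i → i ∈ F × G i x))

GenType1 : Set' → Set₁
GenType1 A = Generates {⊤} (λ _ → ∅) A

GenType2 : Set' → Set₁
GenType2 A = ∃ λ (R : Set') → Computable R × Infinite R × Generates {⊤} (λ _ → R) A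

GenType3 : Set' → Set₁
GenType3 A = ∃ λ (W : Set') → CE W × ¬ Computable W × Infinite W
                            × Generates {⊤} (λ _ → W) A

Type1 : Set' → Set₁
Type1 A = GenType1 A

Type2 : Set' → Set₁
Type2 A = GenType2 A × ¬ GenType1 A

Type3 : Set' → Set₁
Type3 A = GenType3 A × ¬ GenType1 A × ¬ GenType2 A

{-# OPTIONS --safe #-}

-- Let W generate D(A), with W = ∅ or W noncomputable, and let N be the complement of A ∪ W, which
-- D-maximality makes cohesive (for computable sets). If B ≡m A via f : A → B and g : B → A, then
-- e = g ∘ f reduces A to itself, so e⁻¹(W) ⊆* W. By cohesiveness e(x) < x, e(x) > x or e(x) = x
-- almost everywhere on N. In the first case, iterating e downwards from x ends in A ∪ W or in a
-- finite set, which decides A; in the second, an orbit of e is an infinite c.e. subset of N. So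
-- e(x) = x almost everywhere on N, and f is injective there. Every other x, up to finitely many,
-- lies in A or W; since f(A), and f(W) unless W = ∅, are infinite, x can be sent to some f(z) ≥ x
-- with z on the same side. This gives A ≤fo B, so C = A works for Types 1 and 3. For Type 2,
-- C = A ∪ R is in the same situation with W = ∅.

module Submission where

open import Defs
open import Level using (0ℓ)
open import Data.Nat
open import Data.Nat.Properties
open import Data.Fin using (Fin; zero; suc)
open import Data.Vec using (Vec; []; _∷_; lookup; tail)
open import Data.Maybe using (Maybe; just; nothing; _>>=_)
open import Data.Maybe.Properties using (just-injective)
open import Data.Product using (Σ; ∃; _×_; _,_; proj₁; proj₂)
open import Data.Sum using (_⊎_; inj₁; inj₂; [_,_]′)
open import Data.Empty using (⊥; ⊥-elim)
open import Data.Unit using (⊤; tt)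
open import Function.Base using (_∘_; id)
open import Function.Bundles using (_⇔_; mk⇔; module Equivalence)
open import Function.Properties.Equivalence using ()
  renaming (refl to ⇔-refl; trans to ⇔-trans)
open import Relation.Nullary using (¬_; yes; no; contradiction)
open import Relation.Nullary.Decidable using (decidable-stable)
open import Relation.Binary.PropositionalEquality
open import Axiom.ExcludedMiddle using (ExcludedMiddle)
open Equivalence using (to; from)

private variable
  m n : ℕ

-- Fuel monotonicity and determinism of evaluation

>>=-mono : ∀ {X Y : Set} {p p′ : Maybe X} {k k′ : X → Maybe Y} {z} →
  (∀ {y} → p ≡ just y → p′ ≡ just y) →
  (∀ y → k y ≡ just z → k′ y ≡ just z) →
  (p >>= k) ≡ just z → (p′ >>= k′) ≡ just z
>>=-mono {p = just y} p⊑p′ k⊑k′ eq rewrite p⊑p′ refl = k⊑k′ y eq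

mutual
  eval-step : ∀ f (c : Code n) v {y} → eval f c v ≡ just y → eval (suc f) c v ≡ just y
  eval-step (suc f) zer v eq = eq
  eval-step (suc f) succ (x ∷ []) eq = eq
  eval-step (suc f) (proj i) v eq = eq
  eval-step (suc f) (comp g hs) v eq =
    >>=-mono {p = evalVec f hs v} (evalVec-step f hs v) (λ w → eval-step f g w) eq
  eval-step (suc f) (prec g h) (x ∷ v) eq = evalPrec-step f g h x v eq
  eval-step (suc f) (mu g) v eq = evalMu-step f g v 0 eq

  evalVec-step : ∀ f (cs : Vec (Code n) m) v {ys} →
    evalVec f cs v ≡ just ys → evalVec (suc f) cs v ≡ just ys
  evalVec-step f [] v eq = eq
  evalVec-step f (c ∷ cs) v eq =
    >>=-mono {p = eval f c v} (eval-step f c v)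
      (λ y → >>=-mono {p = evalVec f cs v} (evalVec-step f cs v) (λ ys eq → eq)) eq

  evalPrec-step : ∀ f (g : Code n) h x v {y} →
    evalPrec f g h x v ≡ just y → evalPrec (suc f) g h x v ≡ just y
  evalPrec-step f g h zero v eq = eval-step f g v eq
  evalPrec-step f g h (suc x) v eq =
    >>=-mono {p = evalPrec f g h x v} (evalPrec-step f g h x v)
      (λ r → eval-step f h (x ∷ r ∷ v)) eq

  evalMu-step : ∀ f (g : Code (suc n)) v k {y} →
    evalMu f g v k ≡ just y → evalMu (suc f) g v k ≡ just y
  evalMu-step (suc f) g v k eq =
    >>=-mono {p = eval f g (k ∷ v)} (eval-step f g (k ∷ v))
      (λ { zero eq → eq ; (suc _) eq → evalMu-step f g v (suc k) eq }) eq

fuel-mono : {X : Set} (φ : ℕ → Maybe X) →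
  (∀ f {y} → φ f ≡ just y → φ (suc f) ≡ just y) →
  ∀ {f f′ y} → f ≤ f′ → φ f ≡ just y → φ f′ ≡ just y
fuel-mono φ step f≤f′ = go (≤⇒≤′ f≤f′)
  where
  go : ∀ {f f′ y} → f ≤′ f′ → φ f ≡ just y → φ f′ ≡ just y
  go ≤′-refl        eq = eq
  go (≤′-step f≤f′) eq = step _ (go f≤f′ eq)

eval-mono : ∀ {f f′} (c : Code n) v {y} → f ≤ f′ → eval f c v ≡ just y → eval f′ c v ≡ just y
eval-mono c v = fuel-mono (λ f → eval f c v) (λ f → eval-step f c v)

evalVec-mono : ∀ {f f′} (cs : Vec (Code n) m) v {ys} →
  f ≤ f′ → evalVec f cs v ≡ just ys → evalVec f′ cs v ≡ just ys
evalVec-mono cs v = fuel-mono (λ f → evalVec f cs v) (λ f → evalVec-step f cs v)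

evalPrec-mono : ∀ {f f′} (g : Code n) h x v {y} →
  f ≤ f′ → evalPrec f g h x v ≡ just y → evalPrec f′ g h x v ≡ just y
evalPrec-mono g h x v = fuel-mono (λ f → evalPrec f g h x v) (λ f → evalPrec-step f g h x v)

evalMu-mono : ∀ {f f′} (g : Code (suc n)) v k {y} →
  f ≤ f′ → evalMu f g v k ≡ just y → evalMu f′ g v k ≡ just y
evalMu-mono g v k = fuel-mono (λ f → evalMu f g v k) (λ f → evalMu-step f g v k)

eval-det : ∀ f f′ (c : Code n) v {y y′} →
  eval f c v ≡ just y → eval f′ c v ≡ just y′ → y ≡ y′
eval-det f f′ c v p q = just-injective
  (trans (sym (eval-mono c v (m≤m⊔n f f′) p)) (eval-mono c v (m≤n⊔m f f′) q))

-- Total computable functions and their closure properties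

-- The function is an index and its code a field, so that codes are assembled along the expression
-- for the function and never have to be compared with it afterwards.
record Comp (g : Vec ℕ n → ℕ) : Set where
  constructor mkComp
  field
    code  : Code n
    halts : ∀ v → ∃ λ f → eval f code v ≡ just (g v)
open Comp

record CompVec (h : Vec ℕ n → Vec ℕ m) : Set where
  constructor mkCompVec
  field
    component : ∀ i → Comp (λ v → lookup (h v) i)
open CompVec

Comp-ext : {g h : Vec ℕ n → ℕ} → (∀ v → g v ≡ h v) → Comp g → Comp h
Comp-ext g≗h (mkComp c halt) =
  mkComp c λ v → proj₁ (halt v) , trans (proj₂ (halt v)) (cong just (g≗h v))

var : (i : Fin n) → Comp (λ v → lookup v i)
var i = mkComp (proj i) λ v → 1 , refl

idV : CompVec {n} (λ v → v)
idV = mkCompVec var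

[]V : CompVec {n} (λ _ → [])
[]V = mkCompVec λ ()

infixr 5 _∷V_
_∷V_ : {a : Vec ℕ n → ℕ} {h : Vec ℕ n → Vec ℕ m} →
  Comp a → CompVec h → CompVec (λ v → a v ∷ h v)
component (a ∷V h) zero    = a
component (a ∷V h) (suc i) = component h i

lookup-tail : (v : Vec ℕ (suc n)) (i : Fin n) → lookup v (suc i) ≡ lookup (tail v) i
lookup-tail (x ∷ v) i = refl

tailV : {h : Vec ℕ n → Vec ℕ (suc m)} → CompVec h → CompVec (λ v → tail (h v))
component (tailV {h = h} hV) i = Comp-ext (λ v → lookup-tail (h v) i) (component hV (suc i))

opaque
  vecCode : (h : Vec ℕ n → Vec ℕ m) → CompVec h →
    ∃ λ cs → ∀ v → ∃ λ f → evalVec f cs v ≡ just (h v)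
  vecCode {m = zero} h hV = [] , λ v → 0 , cong just ([]-η (h v))
    where
    []-η : (ys : Vec ℕ 0) → [] ≡ ys
    []-η [] = refl
  vecCode {m = suc m} h hV with component hV zero | vecCode (λ v → tail (h v)) (tailV hV)
  ... | mkComp c halt | cs , halts′ = c ∷ cs , λ v → proj₁ (halt v) ⊔ proj₁ (halts′ v) , correct v
    where
    ∷-η : (ys : Vec ℕ (suc m)) → lookup ys zero ∷ tail ys ≡ ys
    ∷-η (y ∷ ys) = refl
    correct : ∀ v → evalVec (proj₁ (halt v) ⊔ proj₁ (halts′ v)) (c ∷ cs) v ≡ just (h v)
    correct v
      rewrite eval-mono c v (m≤m⊔n (proj₁ (halt v)) (proj₁ (halts′ v))) (proj₂ (halt v))
            | evalVec-mono cs v (m≤n⊔m (proj₁ (halt v)) (proj₁ (halts′ v))) (proj₂ (halts′ v))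
            = cong just (∷-η (h v))

  compC : {g : Vec ℕ m → ℕ} {h : Vec ℕ n → Vec ℕ m} → Comp g → CompVec h → Comp (λ v → g (h v))
  compC {g = g} {h} (mkComp c halt) hV with vecCode h hV
  ... | cs , halts′ = mkComp (comp c cs) λ v → suc (proj₁ (halts′ v) ⊔ proj₁ (halt (h v))) , correct v
    where
    correct : ∀ v → eval (suc (proj₁ (halts′ v) ⊔ proj₁ (halt (h v)))) (comp c cs) v ≡ just (g (h v))
    correct v
      rewrite evalVec-mono cs v (m≤m⊔n (proj₁ (halts′ v)) (proj₁ (halt (h v)))) (proj₂ (halts′ v))
            = eval-mono c (h v) (m≤n⊔m (proj₁ (halts′ v)) (proj₁ (halt (h v)))) (proj₂ (halt (h v)))

primrec : ℕ → (ℕ → ℕ → ℕ) → ℕ → ℕ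
primrec z s zero    = z
primrec z s (suc x) = s x (primrec z s x)

opaque
  recC : {g : Vec ℕ n → ℕ} {h : Vec ℕ (suc (suc n)) → ℕ} {a : Vec ℕ n → ℕ} →
    Comp g → Comp h → Comp a → Comp (λ v → primrec (g v) (λ i r → h (i ∷ r ∷ v)) (a v))
  recC {n = n} {g} {h} {a} (mkComp cg haltg) (mkComp ch halth) aC =
    -- `prec` recurses on its first argument, so the number of rounds `a v` is put in front of the
    -- parameters `v`.
    compC {g = λ w → primrec (g (tail w)) (λ i r → h (i ∷ r ∷ tail w)) (lookup w zero)}
          (mkComp (prec cg ch) correct) (aC ∷V idV)
    where
    loop : ∀ x v → ∃ λ f →
      evalPrec f cg ch x v ≡ just (primrec (g v) (λ i r → h (i ∷ r ∷ v)) x)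
    loop zero v = haltg v
    loop (suc x) v with loop x v
    ... | f , eq with halth (x ∷ primrec (g v) (λ i r → h (i ∷ r ∷ v)) x ∷ v)
    ... | f′ , eq′ = f ⊔ f′ , total
      where
      total : evalPrec (f ⊔ f′) cg ch (suc x) v
                ≡ just (primrec (g v) (λ i r → h (i ∷ r ∷ v)) (suc x))
      total rewrite evalPrec-mono cg ch x v (m≤m⊔n f f′) eq = eval-mono ch _ (m≤n⊔m f f′) eq′
    correct : (w : Vec ℕ (suc n)) → ∃ λ f → eval f (prec cg ch) w
      ≡ just (primrec (g (tail w)) (λ i r → h (i ∷ r ∷ tail w)) (lookup w zero))
    correct (x ∷ v) = suc (proj₁ (loop x v)) , proj₂ (loop x v)

  sucC : {a : Vec ℕ n → ℕ} → Comp a → Comp (λ v → suc (a v))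
  sucC aC = compC {g = λ w → suc (lookup w zero)} (mkComp succ λ { (x ∷ []) → 1 , refl }) (aC ∷V []V)

  constC : (k : ℕ) → Comp {n} (λ _ → k)
  constC zero    = mkComp zer λ v → 1 , refl
  constC (suc k) = sucC (constC k)

  predC : {a : Vec ℕ n → ℕ} → Comp a → Comp (λ v → pred (a v))
  predC {a = a} aC = Comp-ext (λ v → lemma (a v)) (recC (constC 0) (var zero) aC)
    where
    lemma : ∀ x → primrec 0 (λ i _ → i) x ≡ pred x
    lemma zero    = refl
    lemma (suc x) = refl

infixl 6 _+C_ _∸C_
infixl 7 _*C_

opaque
  _+C_ : {a b : Vec ℕ n → ℕ} → Comp a → Comp b → Comp (λ v → a v + b v)
  _+C_ {a = a} {b} aC bC =
    Comp-ext (λ v → lemma (b v) (a v)) (recC bC (sucC (var (suc zero))) aC)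
    where
    lemma : ∀ y x → primrec y (λ _ r → suc r) x ≡ x + y
    lemma y zero    = refl
    lemma y (suc x) = cong suc (lemma y x)

  _∸C_ : {a b : Vec ℕ n → ℕ} → Comp a → Comp b → Comp (λ v → a v ∸ b v)
  _∸C_ {a = a} {b} aC bC =
    Comp-ext (λ v → lemma (a v) (b v)) (recC aC (predC (var (suc zero))) bC)
    where
    lemma : ∀ x y → primrec x (λ _ r → pred r) y ≡ x ∸ y
    lemma x zero    = refl
    lemma x (suc y) = trans (cong pred (lemma x y)) (pred[m∸n]≡m∸[1+n] x y)

  _*C_ : {a b : Vec ℕ n → ℕ} → Comp a → Comp b → Comp (λ v → a v * b v)
  _*C_ {a = a} {b} aC bC = Comp-ext (λ v → lemma (b v) (a v))
    (recC (constC 0) (compC bC (tailV (tailV idV)) +C var (suc zero)) aC)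
    where
    lemma : ∀ y x → primrec 0 (λ _ r → y + r) x ≡ x * y
    lemma y zero    = refl
    lemma y (suc x) = cong (y +_) (lemma y x)

ifz : ∀ {X : Set} → ℕ → X → X → X
ifz zero    x y = x
ifz (suc _) x y = y

opaque
  ifzC : {c a b : Vec ℕ n → ℕ} → Comp c → Comp a → Comp b → Comp (λ v → ifz (c v) (a v) (b v))
  ifzC {c = c} {a} {b} cC aC bC = Comp-ext (λ v → lemma (c v) (a v) (b v))
    (recC aC (compC bC (tailV (tailV idV))) cC)
    where
    lemma : ∀ k x y → primrec x (λ _ _ → y) k ≡ ifz k x y
    lemma zero    x y = refl
    lemma (suc k) x y = refl

-- With `0` as the code of truth, a product is a disjunction and a sum a conjunction; this one is
-- the bounded existential quantifier over `i < k`.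
∏< : ℕ → (ℕ → ℕ) → ℕ
∏< k h = primrec 1 (λ i r → h i * r) k

opaque
  ∏C : {h : Vec ℕ (suc n) → ℕ} {a : Vec ℕ n → ℕ} →
    Comp h → Comp a → Comp (λ v → ∏< (a v) (λ i → h (i ∷ v)))
  ∏C hC aC =
    recC (constC 1) (compC hC (var zero ∷V tailV (tailV idV)) *C var (suc zero)) aC

∏<-zero⁺ : ∀ {i k} (h : ℕ → ℕ) → i < k → h i ≡ 0 → ∏< k h ≡ 0
∏<-zero⁺ {i} {suc k} h i<1+k hi≡0 with m≤n⇒m<n∨m≡n (≤-pred i<1+k)
... | inj₁ i<k  = trans (cong (h k *_) (∏<-zero⁺ h i<k hi≡0)) (*-zeroʳ (h k))
... | inj₂ refl = cong (_* ∏< k h) hi≡0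

∏<-zero⁻ : ∀ k (h : ℕ → ℕ) → ∏< k h ≡ 0 → ∃ λ i → h i ≡ 0
∏<-zero⁻ (suc k) h eq with m*n≡0⇒m≡0∨n≡0 (h k) eq
... | inj₁ hk≡0 = k , hk≡0
... | inj₂ rest = ∏<-zero⁻ k h rest

-- Unbounded search

module _ {h : Vec ℕ (suc n) → ℕ} (hC : Comp h) where

  evalMu-sound : ∀ f v k {y} → evalMu f (code hC) v k ≡ just y → h (y ∷ v) ≡ 0
  evalMu-sound (suc f) v k eq with eval f (code hC) (k ∷ v) in ev
  evalMu-sound (suc f) v k refl | just zero =
    eval-det (proj₁ (halts hC (k ∷ v))) f (code hC) (k ∷ v) (proj₂ (halts hC (k ∷ v))) ev
  evalMu-sound (suc f) v k eq | just (suc _) = evalMu-sound f v (suc k) eq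

  -- Induction on the distance `d` from the candidate `k` to a known zero. The search may stop at an
  -- earlier zero, so the value it returns is existential.
  evalMu-complete : ∀ v d k → h (d + k ∷ v) ≡ 0 → ∃ λ f → ∃ λ y → evalMu f (code hC) v k ≡ just y
  evalMu-complete v d k hd≡0 with h (k ∷ v) in hk | halts hC (k ∷ v)
  ... | zero | f , eq = suc f , k , lemma
    where
    lemma : evalMu (suc f) (code hC) v k ≡ just k
    lemma rewrite eq = refl
  evalMu-complete v zero k hd≡0 | suc _ | _ with () ← trans (sym hk) hd≡0
  evalMu-complete v (suc d) k hd≡0 | suc _ | f , eq
    with evalMu-complete v d (suc k) (trans (cong (λ j → h (j ∷ v)) (+-suc d k)) hd≡0)
  ... | f′ , y , eq′ = suc (f ⊔ f′) , y , lemma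
    where
    lemma : evalMu (suc (f ⊔ f′)) (code hC) v k ≡ just y
    lemma rewrite eval-mono (code hC) (k ∷ v) (m≤m⊔n f f′) eq =
      evalMu-mono (code hC) v (suc k) (m≤n⊔m f f′) eq′

  eval-mu-sound : ∀ f v {y} → eval f (mu (code hC)) v ≡ just y → h (y ∷ v) ≡ 0
  eval-mu-sound (suc f) v = evalMu-sound f v 0

  eval-mu-complete : ∀ v k → h (k ∷ v) ≡ 0 → ∃ λ f → ∃ λ y → eval f (mu (code hC)) v ≡ just y
  eval-mu-complete v k hk≡0
    with evalMu-complete v k 0 (trans (cong (λ j → h (j ∷ v)) (+-identityʳ k)) hk≡0)
  ... | f , y , eq = suc f , y , eq

  opaque
    minimize : (∀ v → ∃ λ k → h (k ∷ v) ≡ 0) → ∃ λ m → Comp m × (∀ v → h (m v ∷ v) ≡ 0)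
    minimize zeros =
      (λ v → proj₁ (proj₂ (search v))) ,
      mkComp (mu (code hC)) (λ v → proj₁ (search v) , proj₂ (proj₂ (search v))) ,
      (λ v → eval-mu-sound (proj₁ (search v)) v (proj₂ (proj₂ (search v))))
      where
      search : ∀ v → ∃ λ f → ∃ λ y → eval f (mu (code hC)) v ≡ just y
      search v = eval-mu-complete v (proj₁ (zeros v)) (proj₂ (zeros v))

-- Computability of the clocked evaluator

enc : Maybe ℕ → ℕ
enc nothing  = 0
enc (just y) = suc y

enc->>= : (p : Maybe ℕ) (k : ℕ → Maybe ℕ) → enc (p >>= k) ≡ ifz (enc p) 0 (enc (k (pred (enc p))))
enc->>= nothing  k = refl
enc->>= (just y) k = refl

-- Without fuel every code gives `nothing`, encoded as `0`; otherwise `body` receives the fuel that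
-- is left after one unit has been spent.
fuelled : {body : Vec ℕ (suc n) → ℕ} (c : Code n) → Comp body →
  (∀ f v → body (f ∷ v) ≡ enc (eval (suc f) c v)) →
  Comp (λ w → enc (eval (lookup w zero) c (tail w)))
fuelled c bodyC body≡ = Comp-ext (λ { (zero ∷ v) → refl ; (suc f ∷ v) → body≡ f v })
  (ifzC (var zero) (constC 0) (compC bodyC (predC (var zero) ∷V tailV idV)))

opaque
  -- The clocked evaluator of a fixed code is itself total computable, so no universal machine is
  -- needed to dovetail enumerations.
  mutual
    evalC : (c : Code n) → Comp (λ w → enc (eval (lookup w zero) c (tail w)))
    evalC zer      = fuelled zer (constC 1) λ f v → refl
    evalC succ     = fuelled succ (sucC (sucC (var (suc zero)))) λ { f (x ∷ []) → refl }
    evalC (proj i) = fuelled (proj i) (sucC (var (suc i))) λ f v → refl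
    evalC {n} (comp {m} g hs) with evalVecC hs
    ... | flag , flagC , h , hV , evalVec≡ =
      fuelled (comp g hs) (ifzC flagC (constC 0) (compC (evalC g) (var zero ∷V hV))) λ f v →
        trans (>>=-ifz (eval f g) (flag (f ∷ v)) (h (f ∷ v)))
              (cong (λ p → enc (p >>= eval f g)) (sym (evalVec≡ (f ∷ v))))
      where
      >>=-ifz : ∀ (φ : Vec ℕ m → Maybe ℕ) (k : ℕ) (ys : Vec ℕ m) →
        ifz k 0 (enc (φ ys)) ≡ enc (ifz k nothing (just ys) >>= φ)
      >>=-ifz φ zero    ys = refl
      >>=-ifz φ (suc k) ys = refl
    evalC {suc n} (prec g h) = fuelled (prec g h)
      (recC (compC (evalC g) (var zero ∷V tailV (tailV idV)))
            -- An accumulator `0` records that an earlier round ran out of fuel and stays `0`;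
            -- otherwise `pred` recovers the value.
            (ifzC (var (suc zero)) (constC 0)
              (compC (evalC h) (var (suc (suc zero)) ∷V var zero ∷V predC (var (suc zero))
                                  ∷V tailV (tailV (tailV (tailV idV))))))
            (var (suc zero)))
      λ { f (x ∷ v) → loop f v x }
      where
      loop : ∀ f v x →
        primrec (enc (eval f g v)) (λ i r → ifz r 0 (enc (eval f h (i ∷ pred r ∷ v)))) x
          ≡ enc (evalPrec f g h x v)
      loop f v zero    = refl
      loop f v (suc x) rewrite loop f v x =
        sym (enc->>= (evalPrec f g h x v) λ r → eval f h (x ∷ r ∷ v))
    evalC {n} (mu g) = fuelled (mu g)
      -- The recursion is on the remaining fuel: the accumulator for one unit less is the outcome of
      -- the search from the next candidate.
      (recC (constC 0)
        (ifzC gC (constC 0)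
          (ifzC (predC gC) (sucC (var (suc (suc zero)) ∸C sucC (var zero))) (var (suc zero))))
        (var zero))
      λ f v → trans (loop f v f ≤-refl) (cong (λ k → enc (evalMu f g v k)) (n∸n≡0 f))
      where
      -- A search started with fuel f has reached candidate f ∸ suc i when i units remain.
      gC : Comp {suc (suc (suc n))} (λ w → enc (eval (lookup w zero) g
             (lookup w (suc (suc zero)) ∸ suc (lookup w zero) ∷ tail (tail (tail w)))))
      gC = compC (evalC g) (var zero ∷V (var (suc (suc zero)) ∸C sucC (var zero))
                              ∷V tailV (tailV (tailV idV)))
      loop : ∀ f v i → i ≤ f →
        primrec 0 (λ i r → ifz (enc (eval i g (f ∸ suc i ∷ v))) 0
                    (ifz (pred (enc (eval i g (f ∸ suc i ∷ v)))) (suc (f ∸ suc i)) r)) i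
          ≡ enc (evalMu i g v (f ∸ i))
      loop f v zero    i<f = refl
      loop f v (suc i) i<f with eval i g (f ∸ suc i ∷ v)
      ... | nothing      = refl
      ... | just zero    = refl
      ... | just (suc _) = trans (loop f v i (<⇒≤ i<f))
        (cong (λ k → enc (evalMu i g v k)) (+-∸-assoc 1 i<f))

    -- The outcome is split into a flag, which is `0` when some component runs out of fuel, and a
    -- vector of values, in which such a component gets the default `0`.
    evalVecC : (cs : Vec (Code n) m) →
      ∃ λ flag → Comp flag × ∃ λ h → CompVec h ×
        (∀ w → evalVec (lookup w zero) cs (tail w) ≡ ifz (flag w) nothing (just (h w)))
    evalVecC [] = (λ _ → 1) , constC 1 , (λ _ → []) , []V , λ w → refl
    evalVecC {n} (c ∷ cs) with evalVecC cs
    ... | flag , flagC , h , hV , evalVec≡ =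
      _ , ifzC (evalC c) (constC 0) flagC , _ , predC (evalC c) ∷V hV , correct
      where
      correct : (w : Vec ℕ (suc n)) → evalVec (lookup w zero) (c ∷ cs) (tail w)
        ≡ ifz (ifz (enc (eval (lookup w zero) c (tail w))) 0 (flag w)) nothing
            (just (pred (enc (eval (lookup w zero) c (tail w))) ∷ h w))
      correct w rewrite evalVec≡ w with eval (lookup w zero) c (tail w) | flag w
      ... | nothing | _     = refl
      ... | just y  | zero  = refl
      ... | just y  | suc _ = refl

-- Enumerations, c.e. sets and computable sets

private variable
  A B P R W X Y : Set'
  e f : ℕ → ℕ

opaque
  fnC : ComputableFn f → {a : Vec ℕ n → ℕ} → Comp a → Comp (λ v → f (a v))
  fnC {f = f} (c , halt) aC =
    compC {g = λ w → f (lookup w zero)} (mkComp c λ { (x ∷ []) → halt x }) (aC ∷V []V)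

  computableFn : Comp {1} (λ v → f (lookup v zero)) → ComputableFn f
  computableFn (mkComp c halt) = c , λ x → halt (x ∷ [])

ComputableStage : (ℕ → ℕ → ℕ) → Set
ComputableStage h = Comp {2} (λ v → h (lookup v zero) (lookup v (suc zero)))

-- `stage s x ≡ 0` means that `x` has entered `W` by stage `s`. As `stage` is total, questions about
-- c.e. sets become searches for zeros of computable functions.
record Enumeration (W : Set') : Set where
  field
    stage    : ℕ → ℕ → ℕ
    stageC   : ComputableStage stage
    mono     : ∀ s t x → s ≤ t → stage s x ≡ 0 → stage t x ≡ 0
    sound    : ∀ s x → stage s x ≡ 0 → W x
    complete : ∀ {x} → W x → ∃ λ s → stage s x ≡ 0

  at : {a b : Vec ℕ n → ℕ} → Comp a → Comp b → Comp (λ v → stage (a v) (b v))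
  at aC bC = compC stageC (aC ∷V bC ∷V []V)
open Enumeration

opaque
  enumerate : CE W → Enumeration W
  enumerate {W} (c , W⇔) = record
    { stage    = λ s x → 1 ∸ enc (eval s c (x ∷ []))
    ; stageC   = constC 1 ∸C compC (evalC c) (var zero ∷V var (suc zero) ∷V []V)
    ; mono     = λ s t x s≤t eq → 
        halted (eval-mono c (x ∷ []) s≤t (proj₂ (halted⁻ (eval s c (x ∷ [])) eq)))
    ; sound    = λ s x eq → from (W⇔ x) (s , halted⁻ (eval s c (x ∷ [])) eq)
    ; complete = λ {x} Wx → let s , y , eq = to (W⇔ x) Wx in s , halted eq
    }
    where
    halted : ∀ {p y} → p ≡ just y → 1 ∸ enc p ≡ 0
    halted {y = y} refl = 0∸n≡0 y
    halted⁻ : ∀ p → 1 ∸ enc p ≡ 0 → ∃ λ y → p ≡ just y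
    halted⁻ (just y) eq = y , refl

opaque
  -- `W` is the domain of the search for a zero of `h`.
  ce-from-stage : ∀ h → ComputableStage h → (∀ x → W x ⇔ ∃ λ s → h s x ≡ 0) → CE W
  ce-from-stage h hC W⇔ = mu (code hC) , λ x → ⇔-trans (W⇔ x) (mk⇔
    (λ (s , eq) → eval-mu-complete hC (x ∷ []) s eq)
    (λ (f , y , eq) → y , eval-mu-sound hC f (x ∷ []) eq))

  computable-⇔ : (∀ x → X x ⇔ Y x) → Computable Y → Computable X
  computable-⇔ X⇔Y (χ , χC , Y⇔) = χ , χC , λ x → ⇔-trans (X⇔Y x) (Y⇔ x)

  computable-preimage : ComputableFn e → Computable R → Computable (λ x → R (e x))
  computable-preimage {e} eC (χ , χC , R⇔) =
    (λ x → χ (e x)) , computableFn (fnC χC (fnC eC (var zero))) , λ x → R⇔ (e x)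

  computable-∁ : Computable R → Computable (λ x → ¬ R x)
  computable-∁ {R} (χ , χC , R⇔) =
    (λ x → 1 ∸ χ x) , computableFn (constC 1 ∸C fnC χC (var zero)) , λ x → mk⇔ (fwd x) (bwd x)
    where
    fwd : ∀ x → ¬ R x → 1 ∸ χ x ≡ 0
    fwd x ¬Rx with χ x in eq
    ... | zero  = contradiction (from (R⇔ x) eq) ¬Rx
    ... | suc k = 0∸n≡0 k
    bwd : ∀ x → 1 ∸ χ x ≡ 0 → ¬ R x
    bwd x eq Rx with () ← trans (sym (cong (1 ∸_) (to (R⇔ x) Rx))) eq

  computable-< : ComputableFn e → ComputableFn f → Computable (λ x → e x < f x)
  computable-< {e} {f} eC fC =
    (λ x → suc (e x) ∸ f x) , computableFn (sucC (fnC eC (var zero)) ∸C fnC fC (var zero)) ,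
    λ x → mk⇔ m≤n⇒m∸n≡0 (m∸n≡0⇒m≤n {suc (e x)} {f x})

  idFn : ComputableFn id
  idFn = computableFn (var zero)

  ce-preimage : ComputableFn e → CE W → CE (λ x → W (e x))
  ce-preimage {e} eC ceW = let E = enumerate ceW in
    ce-from-stage (λ s x → stage E s (e x)) (at E (var zero) (fnC eC (var (suc zero))))
      λ x → mk⇔ (complete E) (λ (s , eq) → sound E s (e x) eq)

  ce-∪ : Computable P → CE W → CE (λ x → P x ⊎ W x)
  ce-∪ (χ , χC , P⇔) ceW = let E = enumerate ceW in
    ce-from-stage (λ s x → χ x * stage E s x) (fnC χC (var (suc zero)) *C stageC E) λ x → mk⇔
      [ (λ Px → 0 , cong (_* stage E 0 x) (to (P⇔ x) Px))
      , (λ Wx → let s , eq = complete E Wx in s , trans (cong (χ x *_) eq) (*-zeroʳ (χ x))) ]′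
      (λ (s , eq) → [ inj₁ ∘ from (P⇔ x) , inj₂ ∘ sound E s x ]′ (m*n≡0⇒m≡0∨n≡0 (χ x) eq))

  ce-∅ : CE ∅
  ce-∅ = ce-from-stage (λ _ _ → 1) (constC 1) λ x → mk⇔ (λ ()) (λ { (s , ()) })

  ce-computable : Computable R → CE R
  ce-computable (χ , χC , R⇔) = ce-from-stage (λ _ → χ) (fnC χC (var (suc zero)))
    λ x → mk⇔ (λ Rx → 0 , to (R⇔ x) Rx) (λ (s , eq) → from (R⇔ x) eq)

opaque
  -- Post's theorem: a search finds a stage at which `x` has appeared in `A` or in `B`, and by
  -- disjointness membership in `A` can be read off at that stage.
  enumerations-complementary : Enumeration A → Enumeration B → Disjoint A B →
    (∀ x → A x ⊎ B x) → Computable A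
  enumerations-complementary {A} {B} EA EB disj total
    with minimize (at EA (var zero) (var (suc zero)) *C at EB (var zero) (var (suc zero)))
           (λ v → found (lookup v zero) (total (lookup v zero)))
    where
    found : ∀ x → A x ⊎ B x → ∃ λ s → stage EA s x * stage EB s x ≡ 0
    found x (inj₁ Ax) = let s , eq = complete EA Ax in s , cong (_* stage EB s x) eq
    found x (inj₂ Bx) = let s , eq = complete EB Bx in
      s , trans (cong (stage EA s x *_) eq) (*-zeroʳ (stage EA s x))
  ... | m , mC , m≡0 =
    (λ x → stage EA (m (x ∷ [])) x) ,
    computableFn (at EA (compC mC (var zero ∷V []V)) (var zero)) ,
    λ x → mk⇔ (λ Ax → [ id , (λ eq → ⊥-elim (disj x Ax (sound EB (m (x ∷ [])) x eq))) ]′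
                        (m*n≡0⇒m≡0∨n≡0 (stage EA (m (x ∷ [])) x) (m≡0 (x ∷ []))))
              (sound EA (m (x ∷ [])) x)

computable-complementary : CE A → CE B → Disjoint A B → (∀ x → A x ⊎ B x) → Computable A
computable-complementary ceA ceB = enumerations-complementary (enumerate ceA) (enumerate ceB)

-- Equality test, iteration and dovetailing

dist : ℕ → ℕ → ℕ
dist x y = (x ∸ y) + (y ∸ x)

opaque
  distC : {a b : Vec ℕ n → ℕ} → Comp a → Comp b → Comp (λ v → dist (a v) (b v))
  distC aC bC = (aC ∸C bC) +C (bC ∸C aC)

dist≡0⇔≡ : ∀ x y → dist x y ≡ 0 ⇔ x ≡ y
dist≡0⇔≡ x y = mk⇔
  (λ eq → ≤-antisym (m∸n≡0⇒m≤n (m+n≡0⇒m≡0 (x ∸ y) eq)) (m∸n≡0⇒m≤n (m+n≡0⇒n≡0 (x ∸ y) eq)))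
  (λ { refl → cong₂ _+_ (n∸n≡0 x) (n∸n≡0 x) })

iterate : (ℕ → ℕ) → ℕ → ℕ → ℕ
iterate e x = primrec x (λ _ → e)

opaque
  iterateC : ComputableFn e → {a b : Vec ℕ n → ℕ} → Comp a → Comp b →
    Comp (λ v → iterate e (a v) (b v))
  iterateC eC aC bC = recC aC (fnC eC (var (suc zero))) bC

opaque
  -- Two searches replace a search over pairs: the first finds one number `S` that serves as stage
  -- and as bound for the witness, the second finds a witness at stage `S`.
  dovetail : (H : ℕ → ℕ → ℕ → ℕ) →
    Comp {3} (λ v → H (lookup v zero) (lookup v (suc zero)) (lookup v (suc (suc zero)))) →
    (∀ {s t z x} → s ≤ t → H s z x ≡ 0 → H t z x ≡ 0) →
    (∀ x → ∃ λ s → ∃ λ z → H s z x ≡ 0) →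
    ∃ λ p → ComputableFn p × (∀ x → ∃ λ s → H s (p x) x ≡ 0)
  dovetail H HC H-mono total
    with minimize
           (∏C (compC HC (var (suc zero) ∷V var zero ∷V var (suc (suc zero)) ∷V []V)) (var zero))
           (λ v → let s , z , eq = total (lookup v zero) in
             -- At least `s`, so monotonicity applies, and above `z`, so `z` is within the bounded
             -- search.
             s ⊔ suc z , ∏<-zero⁺ (λ z′ → H (s ⊔ suc z) z′ (lookup v zero))
                           (m≤n⊔m s (suc z)) (H-mono (m≤m⊔n s (suc z)) eq))
  ... | S , SC , S-zero
    with minimize (compC HC (compC SC (var (suc zero) ∷V []V) ∷V var zero ∷V var (suc zero) ∷V []V))
           (λ { v@(x ∷ []) → ∏<-zero⁻ (S v) (λ z → H (S v) z x) (S-zero v) })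
  ... | p , pC , p-zero =
    (λ x → p (x ∷ [])) , computableFn (compC pC (var zero ∷V []V)) ,
    λ x → S (x ∷ []) , p-zero (x ∷ [])

≤m-trans : ∀ (A B C : Set') → A ≤m B → B ≤m C → A ≤m C
≤m-trans A B C (f , fC , A⇔) (g , gC , B⇔) =
  (λ x → g (f x)) , computableFn (fnC gC (fnC fC (var zero))) , λ x → ⇔-trans (A⇔ x) (B⇔ (f x))

-- Finite modifications of computable sets

module Classical (em : ExcludedMiddle 0ℓ) where

  opaque
    -- Induction on the threshold: the characteristic function is corrected at the single point `n`,
    -- with a bit supplied by excluded middle, and the threshold drops by one.
    computable-almost : ∀ n → (∀ x → n ≤ x → X x ⇔ Y x) → Computable Y → Computable X
    computable-almost zero X⇔Y Yc = computable-⇔ (λ x → X⇔Y x z≤n) Yc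
    computable-almost {X} {Y} (suc n) X⇔Y (χ , χC , Y⇔) with bit
      where
      bit : ∃ λ b → X n ⇔ (b ≡ 0)
      bit with em {X n}
      ... | yes Xn = 0 , mk⇔ (λ _ → refl) (λ _ → Xn)
      ... | no ¬Xn = 1 , mk⇔ (⊥-elim ∘ ¬Xn) (λ ())
    ... | b , Xn⇔ = computable-almost n agree
      ( (λ x → ifz (dist x n) b (χ x))
      , computableFn (ifzC (distC (var zero) (constC n)) (constC b) (fnC χC (var zero)))
      , λ x → ⇔-refl)
      where
      agree : ∀ x → n ≤ x → X x ⇔ (ifz (dist x n) b (χ x) ≡ 0)
      agree x n≤x with dist x n in eq
      ... | zero rewrite to (dist≡0⇔≡ x n) eq = Xn⇔
      ... | suc _ with m≤n⇒m<n∨m≡n n≤x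
      ...   | inj₁ n<x  = ⇔-trans (X⇔Y x n<x) (Y⇔ x)
      ...   | inj₂ refl with () ← trans (sym (from (dist≡0⇔≡ x x) refl)) eq

    computable-finite : Finite X → Computable X
    computable-finite (n , X<n) = computable-almost {Y = ∅} n
      (λ x n≤x → mk⇔ (λ Xx → contradiction (X<n x Xx) (≤⇒≯ n≤x)) (λ ()))
      ((λ _ → 1) , computableFn (constC 1) , λ x → mk⇔ (λ ()) (λ ()))

  -- Self-reductions and the cohesive residue

  module Residue {A W : Set'} (ceA : CE A) (ceW : CE W) (A-noncomputable : ¬ Computable A)
    (W∩A≡∅ : Disjoint W A)
    (gen : ∀ D → CE D → Disjoint D A → D ⊆* W)
    (cohesive : ∀ P → Computable P →
      ((λ x → ¬ A x × ¬ W x) ⊆* P) ⊎ ((λ x → ¬ A x × ¬ W x) ⊆* (λ x → ¬ P x)))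
    where

    N : Set'
    N x = ¬ A x × ¬ W x

    module SelfReduction {e : ℕ → ℕ} (eC : ComputableFn e) (A⇔Ae : ∀ x → A x ⇔ A (e x)) where

      A⇔A-iterate : ∀ {d} → (∀ x → A x ⇔ A (d x)) → ∀ k x → A x ⇔ A (iterate d x k)
      A⇔A-iterate A⇔ zero    x = ⇔-refl
      A⇔A-iterate A⇔ (suc k) x = ⇔-trans (A⇔A-iterate A⇔ k x) (A⇔ _)

      lower : ℕ → ℕ
      lower y = ifz (suc (e y) ∸ y) (e y) y

      lower-cases : ∀ y → (e y < y × lower y ≡ e y) ⊎ (¬ e y < y × lower y ≡ y)
      lower-cases y with suc (e y) ∸ y in eq
      ... | zero  = inj₁ (m∸n≡0⇒m≤n eq , refl)
      ... | suc _ = inj₂ ((λ lt → 1+n≢0 (trans (sym eq) (m≤n⇒m∸n≡0 lt))) , refl)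

      -- `x` rounds are enough, since every round that moves lowers a value that starts at `x`.
      lowest : ℕ → ℕ
      lowest x = iterate lower x x

      lowestC : ComputableFn lowest
      lowestC = computableFn (iterateC
        (computableFn (ifzC (sucC (fnC eC (var zero)) ∸C var zero) (fnC eC (var zero)) (var zero)))
        (var zero) (var zero))

      lowest-stuck : ∀ x → ¬ e (lowest x) < lowest x
      lowest-stuck x with progress x
        where
        -- After `x` rounds the second alternative leaves only the value `0`, below which nothing
        -- lies.
        progress : ∀ k → let y = iterate lower x k in ¬ e y < y ⊎ y + k ≤ x
        progress zero    = inj₂ (≤-reflexive (+-identityʳ x))
        progress (suc k) with iterate lower x k | progress k
        ... | y | prev with lower-cases y
        ...   | inj₂ (stuck , eq) rewrite eq = inj₁ stuck
        progress (suc k) | y | inj₁ stuck | inj₁ (ey<y , eq) = contradiction ey<y stuck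
        progress (suc k) | y | inj₂ y+k≤x | inj₁ (ey<y , eq) rewrite eq | +-suc (e y) k =
          inj₂ (≤-trans (+-monoˡ-≤ k ey<y) y+k≤x)
      ... | inj₁ stuck = stuck
      ... | inj₂ y+x≤x = λ lt → 1+n≰n (≤-trans (+-monoˡ-≤ x (≤-trans (s≤s z≤n) lt)) y+x≤x)

      A⇔A-lowest : ∀ x → A x ⇔ A (lowest x)
      A⇔A-lowest x = A⇔A-iterate A⇔lower x x
        where
        A⇔lower : ∀ y → A y ⇔ A (lower y)
        A⇔lower y with lower-cases y
        ... | inj₁ (_ , eq) rewrite eq = A⇔Ae y
        ... | inj₂ (_ , eq) rewrite eq = ⇔-refl

      -- The descent cannot stop in `N` at or above `b`, so `lowest x` is in `A`, in `W`, or below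
      -- `b`. Hence the complement of `A`, pulled back along `lowest`, is c.e. as well, and Post's
      -- theorem would decide `A`.
      not-decreasing : ¬ (N ⊆* (λ x → e x < x))
      not-decreasing (b , decreasing) = A-noncomputable
        (computable-⇔ A⇔A-lowest (computable-complementary
          {A = λ x → A (lowest x)} {B = λ x → (lowest x < b × ¬ A (lowest x)) ⊎ W (lowest x)}
          (ce-preimage {W = A} lowestC ceA)
          (ce-preimage {W = λ y → (y < b × ¬ A y) ⊎ W y} lowestC
            (ce-∪ (computable-finite (b , λ x → proj₁)) ceW))
          (λ x → λ { Al (inj₁ (_ , ¬Al)) → ¬Al Al ; Al (inj₂ Wl) → W∩A≡∅ _ Wl Al })
          decide))
        where
        decide : ∀ x → A (lowest x) ⊎ ((lowest x < b × ¬ A (lowest x)) ⊎ W (lowest x))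
        decide x with em {A (lowest x)} | em {W (lowest x)} | lowest x <? b
        ... | yes Al | _      | _      = inj₁ Al
        ... | no ¬Al | yes Wl | _      = inj₂ (inj₂ Wl)
        ... | no ¬Al | no ¬Wl | yes lt = inj₂ (inj₁ (lt , ¬Al))
        ... | no ¬Al | no ¬Wl | no ≥b  =
          contradiction (decreasing (lowest x) (≮⇒≥ ≥b) (¬Al , ¬Wl)) (lowest-stuck x)

      -- The conclusion is vacuous: `N` has no element from `b₁ ⊔ b₂` on. Such an element would
      -- start an increasing orbit that avoids `A` because `e` reduces `A` to itself, and avoids `W`
      -- because `e` sends only finitely many points outside `W` into `W`.
      increasing⇒fixed : N ⊆* (λ x → x < e x) → N ⊆* (λ x → e x ≡ x)
      increasing⇒fixed (b₁ , increasing)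
        with gen (λ x → W (e x)) (ce-preimage {W = W} eC ceW)
               (λ x We Ax → W∩A≡∅ _ We (to (A⇔Ae x) Ax))
      ... | b₂ , e⁻¹W⊆W with em {∃ λ x → N x × (b₁ ⊔ b₂) ≤ x}
      ...   | no none = b₁ ⊔ b₂ , λ x b≤x Nx → contradiction (x , Nx , b≤x) none
      ...   | yes (x₀ , Nx₀ , b≤x₀) = ⊥-elim escape
        where
        orbit : ℕ → ℕ
        orbit = iterate e x₀
        orbit-N : ∀ k → N (orbit k) × x₀ + k ≤ orbit k
        orbit-N zero    = Nx₀ , ≤-reflexive (+-identityʳ x₀)
        orbit-N (suc k) with orbit k | orbit-N k
        ... | y | (¬Ay , ¬Wy) , x₀+k≤y =
          ( (λ Ae → ¬Ay (from (A⇔Ae y) Ae))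
          , (λ We → ¬Wy (e⁻¹W⊆W y (≤-trans (m≤n⊔m b₁ b₂) b≤y) We))) ,
          ≤-trans (≤-reflexive (+-suc x₀ k))
            (≤-<-trans x₀+k≤y (increasing y (≤-trans (m≤m⊔n b₁ b₂) b≤y) (¬Ay , ¬Wy)))
          where
          b≤y : b₁ ⊔ b₂ ≤ y
          b≤y = ≤-trans b≤x₀ (≤-trans (m≤m+n x₀ k) x₀+k≤y)
        escape : ⊥
        escape with gen (λ y → ∃ λ k → dist (orbit k) y ≡ 0)
          (ce-from-stage (λ k y → dist (orbit k) y)
            (distC (iterateC eC (constC x₀) (var zero)) (var (suc zero))) λ y → ⇔-refl)
          (λ { y (k , eq) Ay → proj₁ (proj₁ (orbit-N k)) (subst A (sym (to (dist≡0⇔≡ _ y) eq)) Ay) })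
        -- The threshold `n` doubles as an index: `orbit n` is at least `n`, hence in `W`, although
        -- the orbit stays in `N`.
        ... | n , orbit⊆W = proj₂ (proj₁ (orbit-N n))
          (orbit⊆W (orbit n) (≤-trans (m≤n+m n x₀) (proj₂ (orbit-N n)))
            (n , from (dist≡0⇔≡ (orbit n) (orbit n)) refl))

      opaque
        almost-fixed : N ⊆* (λ x → e x ≡ x)
        almost-fixed with cohesive _ (computable-< eC idFn) | cohesive _ (computable-< idFn eC)
        ... | inj₁ decreasing | _               = ⊥-elim (not-decreasing decreasing)
        ... | inj₂ _          | inj₁ increasing = increasing⇒fixed increasing
        ... | inj₂ (n₁ , ≮)   | inj₂ (n₂ , ≯)   = n₁ ⊔ n₂ , λ x n≤x Nx →
          ≤-antisym (≮⇒≥ (≯ x (≤-trans (m≤n⊔m n₁ n₂) n≤x) Nx))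
                    (≮⇒≥ (≮ x (≤-trans (m≤m⊔n n₁ n₂) n≤x) Nx))

    -- Unbounded images of `A` and `W`

    -- Otherwise `A` would be the preimage under `f` of the finite set of elements of `B` below `n`,
    -- hence computable.
    A-unbounded : ∀ (B : Set') {f} → ComputableFn f → (∀ x → A x ⇔ B (f x)) →
      ∀ n → ∃ λ z → A z × n ≤ f z
    A-unbounded B {f} fC A⇔Bf n with em {∃ λ z → A z × n ≤ f z}
    ... | yes found = found
    ... | no bounded = ⊥-elim (A-noncomputable (computable-⇔
      (λ x → mk⇔ (λ Ax → ≰⇒> (λ n≤ → bounded (x , Ax , n≤)) , to (A⇔Bf x) Ax)
                 (λ (_ , Bfx) → from (A⇔Bf x) Bfx))
      (computable-preimage {R = λ y → y < n × B y} fC (computable-finite (n , λ y → proj₁)))))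

    -- If `f` stayed below `n` on `W`, the computable set of `x` with `f x` below `n` and outside
    -- `B` would contain `W`. It misses `A`, so it is also almost contained in `W`, which makes `W`
    -- computable.
    W-unbounded : (∀ x → ¬ W x) ⊎ ¬ Computable W → ∀ (B : Set') {f} →
      ComputableFn f → (∀ x → A x ⇔ B (f x)) →
      ∀ x → W x → ∀ n → ∃ λ z → W z × n ≤ f z
    W-unbounded W-cases B {f} fC A⇔Bf x Wx n with W-cases | em {∃ λ z → W z × n ≤ f z}
    ... | inj₁ W≡∅ | _         = contradiction Wx (W≡∅ x)
    ... | inj₂ _   | yes found = found
    ... | inj₂ ¬Wc | no bounded with gen _ (ce-computable preimage)
                                       (λ { x (_ , ¬Bfx) Ax → ¬Bfx (to (A⇔Bf x) Ax) })
      where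
      preimage : Computable (λ x → f x < n × ¬ B (f x))
      preimage = computable-preimage {R = λ y → y < n × ¬ B y} fC (computable-finite (n , λ y → proj₁))
    ...   | k , preimage⊆W = ⊥-elim (¬Wc (computable-almost k
      (λ z k≤z → mk⇔ (λ Wz → ≰⇒> (λ n≤ → bounded (z , Wz , n≤)) ,
                             λ Bfz → W∩A≡∅ z Wz (from (A⇔Bf z) Bfz))
                     (preimage⊆W z k≤z))
      (computable-preimage {R = λ y → y < n × ¬ B y} fC (computable-finite (n , λ y → proj₁)))))

    -- The finite-one reduction

    module Reduction {B : Set'} (W-cases : (∀ x → ¬ W x) ⊎ ¬ Computable W)
      {f : ℕ → ℕ} (fC : ComputableFn f) (A⇔Bf : ∀ x → A x ⇔ B (f x))
      {g : ℕ → ℕ} (gC : ComputableFn g) (B⇔Ag : ∀ y → B y ⇔ A (g y)) where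

      EA : Enumeration A
      EA = enumerate ceA

      EW : Enumeration W
      EW = enumerate ceW

      fixed : N ⊆* (λ x → g (f x) ≡ x)
      fixed = SelfReduction.almost-fixed (computableFn (fnC gC (fnC fC (var zero))))
                (λ x → ⇔-trans (A⇔Bf x) (B⇔Ag (f x)))

      b : ℕ
      b = proj₁ fixed

      -- Zero exactly when `x < b` or `g (f x) ≡ x`. At these points the value `f x` is harmless, as
      -- `g` inverts `f` on all but finitely many of them.
      keep : ℕ → ℕ
      keep x = (suc x ∸ b) * dist (g (f x)) x

      sameSide : ℕ → ℕ → ℕ → ℕ
      sameSide s z x = (stage EA s x + stage EA s z) * (stage EW s x + stage EW s z)

      -- A zero means that `x` is kept, or that by stage `s` the point `z` is seen on the same side
      -- as `x`, with `x ≤ f z`.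
      H : ℕ → ℕ → ℕ → ℕ
      H s z x = keep x * (sameSide s z x + (x ∸ f z))

      keepC : {a : Vec ℕ n → ℕ} → Comp a → Comp (λ v → keep (a v))
      keepC aC = (sucC aC ∸C constC b) *C distC (fnC gC (fnC fC aC)) aC

      HC : Comp {3} (λ v → H (lookup v zero) (lookup v (suc zero)) (lookup v (suc (suc zero))))
      HC = keepC x *C ((at EA s x +C at EA s z) *C (at EW s x +C at EW s z) +C (x ∸C fnC fC z))
        where
        s = var zero
        z = var (suc zero)
        x = var (suc (suc zero))

      both : ∀ {p q} → p ≡ 0 → q ≡ 0 → p + q ≡ 0
      both refl refl = refl

      both-mono : (E : Enumeration Y) → ∀ {s t x z} → s ≤ t →
        stage E s x + stage E s z ≡ 0 → stage E t x + stage E t z ≡ 0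
      both-mono E {s} {x = x} s≤t eq =
        both (mono E _ _ _ s≤t (m+n≡0⇒m≡0 _ eq)) (mono E _ _ _ s≤t (m+n≡0⇒n≡0 (stage E s x) eq))

      *≡0 : ∀ p q → p ≡ 0 ⊎ q ≡ 0 → p * q ≡ 0
      *≡0 p q (inj₁ refl) = refl
      *≡0 p q (inj₂ refl) = *-zeroʳ p

      sameSide-mono : ∀ {s t z x} → s ≤ t → sameSide s z x ≡ 0 → sameSide t z x ≡ 0
      sameSide-mono {s} {t} {z} {x} s≤t eq = *≡0 _ _
        ([ inj₁ ∘ both-mono EA s≤t , inj₂ ∘ both-mono EW s≤t ]′
           (m*n≡0⇒m≡0∨n≡0 (stage EA s x + stage EA s z) eq))

      H-mono : ∀ {s t z x} → s ≤ t → H s z x ≡ 0 → H t z x ≡ 0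
      H-mono {s} {t} {z} {x} s≤t eq = *≡0 (keep x) _
        ([ inj₁ , (λ eq′ → inj₂ (both (sameSide-mono {z = z} {x} s≤t (m+n≡0⇒m≡0 _ eq′))
                                      (m+n≡0⇒n≡0 (sameSide s z x) eq′))) ]′
           (m*n≡0⇒m≡0∨n≡0 (keep x) eq))

      common : (E : Enumeration Y) → ∀ {x z} → Y x → Y z →
        ∃ λ s → stage E s x + stage E s z ≡ 0
      common E Yx Yz with complete E Yx | complete E Yz
      ... | s , eq | t , eq′ =
        s ⊔ t , both (mono E _ _ _ (m≤m⊔n s t) eq) (mono E _ _ _ (m≤n⊔m s t) eq′)

      -- On `A` and on `W` a substitute exists because `f` is unbounded there. Any other `x` is in
      -- `N`, hence below `b` or fixed by `g ∘ f`, and is kept.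
      H-total : ∀ x → ∃ λ s → ∃ λ z → H s z x ≡ 0
      H-total x with em {A x} | em {W x}
      ... | yes Ax | _ with A-unbounded B fC A⇔Bf x
      ...   | z , Az , x≤fz with common EA Ax Az
      ...     | s , eq = s , z , *≡0 (keep x) _ (inj₂ (both (*≡0 _ _ (inj₁ eq)) (m≤n⇒m∸n≡0 x≤fz)))
      H-total x | no _ | yes Wx with W-unbounded W-cases B fC A⇔Bf x Wx x
      ...   | z , Wz , x≤fz with common EW Wx Wz
      ...     | s , eq = s , z , *≡0 (keep x) _
        (inj₂ (both (*≡0 (stage EA s x + stage EA s z) _ (inj₂ eq)) (m≤n⇒m∸n≡0 x≤fz)))
      H-total x | no ¬Ax | no ¬Wx = 0 , 0 , *≡0 (keep x) _ (inj₁ kept)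
        where
        kept : keep x ≡ 0
        kept with x <? b
        ... | yes x<b = *≡0 (suc x ∸ b) _ (inj₁ (m≤n⇒m∸n≡0 x<b))
        ... | no x≮b  = *≡0 (suc x ∸ b) _
          (inj₂ (from (dist≡0⇔≡ _ x) (proj₂ fixed x (≮⇒≥ x≮b) (¬Ax , ¬Wx))))

      opaque
        search : ∃ λ p → ComputableFn p × (∀ x → ∃ λ s → H s (p x) x ≡ 0)
        search = dovetail H HC (λ {s} {t} {z} {x} → H-mono {s} {t} {z} {x}) H-total

      p : ℕ → ℕ
      p = proj₁ search

      k : ℕ → ℕ
      k x = ifz (keep x) (f x) (f (p x))

      kC : ComputableFn k
      kC = computableFn (ifzC (keepC (var zero)) (fnC fC (var zero))
                                (fnC fC (fnC (proj₁ (proj₂ search)) (var zero))))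

      k-cases : ∀ x → (keep x ≡ 0 × k x ≡ f x) ⊎
        (k x ≡ f (p x) × x ≤ f (p x) × ((A x × A (p x)) ⊎ (W x × W (p x))))
      k-cases x with keep x | proj₂ (proj₂ search) x
      ... | zero  | _ = inj₁ (refl , refl)
      ... | suc i | s , eq with m*n≡0⇒m≡0∨n≡0 (suc i) eq
      ...   | inj₂ eq′ = inj₂ (refl , m∸n≡0⇒m≤n (m+n≡0⇒n≡0 (sameSide s (p x) x) eq′) ,
        [ inj₁ ∘ members EA , inj₂ ∘ members EW ]′
          (m*n≡0⇒m≡0∨n≡0 (stage EA s x + stage EA s (p x)) (m+n≡0⇒m≡0 _ eq′)))
        where
        members : (E : Enumeration Y) → stage E s x + stage E s (p x) ≡ 0 → Y x × Y (p x)
        members E eq = sound E _ _ (m+n≡0⇒m≡0 _ eq) , sound E _ _ (m+n≡0⇒n≡0 (stage E s x) eq)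

      A⇔Bk : ∀ x → A x ⇔ B (k x)
      A⇔Bk x with k-cases x
      ... | inj₁ (_ , eq) rewrite eq = A⇔Bf x
      ... | inj₂ (eq , _ , side) rewrite eq = ⇔-trans (agree side) (A⇔Bf (p x))
        where
        agree : (A x × A (p x)) ⊎ (W x × W (p x)) → A x ⇔ A (p x)
        agree (inj₁ (Ax , Apx)) = mk⇔ (λ _ → Apx) (λ _ → Ax)
        agree (inj₂ (Wx , Wpx)) = mk⇔ (⊥-elim ∘ W∩A≡∅ x Wx) (⊥-elim ∘ W∩A≡∅ (p x) Wpx)

      -- If `k x ≡ y`, then `x < b`, or `x ≡ g (f x) ≡ g y`, or `x ≤ f (p x) ≡ y`; the sum bounds
      -- all three cases.
      fibre : ∀ y → Finite (λ x → k x ≡ y)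
      fibre y = suc (b + (g y + y)) , λ x kx≡y → s≤s (bound x kx≡y)
        where
        bound : ∀ x → k x ≡ y → x ≤ b + (g y + y)
        bound x refl with k-cases x
        ... | inj₂ (eq , x≤ , _) rewrite eq =
          ≤-trans x≤ (≤-trans (m≤n+m (f (p x)) (g (f (p x)))) (m≤n+m _ b))
        ... | inj₁ (kept , eq) rewrite eq with m*n≡0⇒m≡0∨n≡0 (suc x ∸ b) kept
        ...   | inj₁ x<b = ≤-trans (<⇒≤ (m∸n≡0⇒m≤n x<b)) (m≤m+n b _)
        ...   | inj₂ gfx≡x = ≤-trans (≤-reflexive (sym (to (dist≡0⇔≡ _ x) gfx≡x)))
          (≤-trans (m≤m+n _ (f x)) (m≤n+m _ b))

    ≡m⇒≤fo : (∀ x → ¬ W x) ⊎ ¬ Computable W → ∀ B → B ≡m A → A ≤fo B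
    ≡m⇒≤fo W-cases B ((g , gC , B⇔Ag) , (f , fC , A⇔Bf)) = k , kC , A⇔Bk , fibre
      where open Reduction {B} W-cases fC A⇔Bf gC B⇔Ag

  -- Cohesiveness from D-maximality

  -- D-maximality is applied to the union of `P` and `A`. If `P` minus `A` is c.e., it is almost
  -- contained in `W`, and `N` almost avoids `P`. Otherwise the complement of `R` is c.e. and misses
  -- `A`, so almost all of `N` is in `R` and hence in `P`.
  residue-cohesive : DMaximal A → (∀ D → CE D → Disjoint D A → D ⊆* W) → ∀ P → Computable P →
    ((λ x → ¬ A x × ¬ W x) ⊆* P) ⊎ ((λ x → ¬ A x × ¬ W x) ⊆* (λ x → ¬ P x))
  residue-cohesive {A} {W} (ceA , _ , split) gen P Pc
    with split (λ x → P x ⊎ A x) (ce-∪ Pc ceA) (λ x → inj₂)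
  ... | inj₁ ceP∖A with gen _ ceP∖A (λ { x (_ , ¬Ax) Ax → ¬Ax Ax })
  ...   | n , P∖A⊆W = inj₂ (n , λ { x n≤x (¬Ax , ¬Wx) Px → ¬Wx (P∖A⊆W x n≤x (inj₁ Px , ¬Ax)) })
  residue-cohesive {A} {W} (ceA , _ , split) gen P Pc | inj₂ (R , Rc , A⊆R , R⊆P∪A)
    with gen _ (ce-computable (computable-∁ Rc)) (λ x ¬Rx Ax → ¬Rx (A⊆R x Ax))
  ...   | n , ∁R⊆W = inj₁ (n , λ { x n≤x (¬Ax , ¬Wx) →
          [ id , ⊥-elim ∘ ¬Ax ]′ (R⊆P∪A x (decidable-stable em (λ ¬Rx → ¬Wx (∁R⊆W x n≤x ¬Rx)))) })

  generated : Generates {⊤} (λ _ → W) A → ∀ D → CE D → Disjoint D A → D ⊆* W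
  generated (_ , gen) D ceD disj with gen D ceD disj
  ... | _ , n , D⊆W = n , λ x n≤x Dx → proj₂ (proj₂ (D⊆W x n≤x Dx))

  leastFo : DMaximal A → Generates {⊤} (λ _ → W) A → (∀ x → ¬ W x) ⊎ ¬ Computable W →
    ∀ B → B ≡m A → A ≤fo B
  leastFo dmax@(ceA , ¬Ac , _) G W-cases = Residue.≡m⇒≤fo ceA (proj₁ (proj₁ G tt)) ¬Ac
    (proj₂ (proj₁ G tt)) (generated G) (residue-cohesive dmax (generated G)) W-cases

  ≤m-refl : A ≤m A
  ≤m-refl = id , idFn , λ x → ⇔-refl

  -- Type 2: absorbing the computable generator

  module _ {A R : Set'} (dmax : DMaximal A) (Rc : Computable R)
    (G : Generates {⊤} (λ _ → R) A) where

    A∪R : Set'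
    A∪R x = R x ⊎ A x

    private
      ceA = proj₁ dmax
      ¬Ac = proj₁ (proj₂ dmax)
      R∩A≡∅ = proj₂ (proj₁ G tt)
      χ = proj₁ Rc
      χC = proj₁ (proj₂ Rc)
      R⇔ = proj₂ (proj₂ Rc)

    -- Were it computable, the complement of `A`, which is `R` together with the complement of
    -- `A∪R`, would be c.e.
    A∪R-noncomputable : ¬ Computable A∪R
    A∪R-noncomputable A∪Rc = ¬Ac (computable-complementary ceA
      (ce-∪ Rc (ce-computable (computable-∁ A∪Rc)))
      (λ { x Ax (inj₁ Rx) → R∩A≡∅ x Rx Ax ; x Ax (inj₂ ¬A∪R) → ¬A∪R (inj₂ Ax) })
      cover)
      where
      cover : ∀ x → A x ⊎ (R x ⊎ ¬ A∪R x)
      cover x with em {A∪R x}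
      ... | yes (inj₁ Rx) = inj₂ (inj₁ Rx)
      ... | yes (inj₂ Ax) = inj₁ Ax
      ... | no ¬A∪R       = inj₂ (inj₂ ¬A∪R)

    replaceR : ∀ c → ComputableFn (λ x → ifz (χ x) c x)
    replaceR c = computableFn (ifzC (fnC χC (var zero)) (constC c) (var zero))

    -- One reduction collapses `R` to an element of `A`, the other to a point outside `A∪R`. Both
    -- points exist by noncomputability.
    A∪R≡mA : A∪R ≡m A
    A∪R≡mA with em {∃ A} | em {∃ λ x → ¬ A∪R x}
    ... | no A≡∅ | _ = ⊥-elim (¬Ac (computable-finite (0 , λ x Ax → ⊥-elim (A≡∅ (x , Ax)))))
    ... | yes _ | no A∪R≡ω = ⊥-elim (A∪R-noncomputable (computable-⇔
      (λ x → mk⇔ (λ z z∈∅ → z∈∅) (λ _ → decidable-stable em λ x∉ → A∪R≡ω (x , x∉)))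
      (computable-∁ (computable-finite {X = ∅} (0 , λ x ())))))
    ... | yes (a , Aa) | yes (n , n∉A∪R) =
      (_ , replaceR a , into) , (_ , replaceR n , outOf)
      where
      into : ∀ x → A∪R x ⇔ A (ifz (χ x) a x)
      into x with χ x in eq
      ... | zero  = mk⇔ (λ _ → Aa) (λ _ → inj₁ (from (R⇔ x) eq))
      ... | suc _ = mk⇔ [ (λ Rx → contradiction (trans (sym eq) (to (R⇔ x) Rx)) 1+n≢0) , id ]′ inj₂
      outOf : ∀ x → A x ⇔ A∪R (ifz (χ x) n x)
      outOf x with χ x in eq
      ... | zero  = mk⇔ (λ Ax → ⊥-elim (R∩A≡∅ x (from (R⇔ x) eq) Ax)) (⊥-elim ∘ n∉A∪R)
      ... | suc _ = mk⇔ inj₂ [ (λ Rx → contradiction (trans (sym eq) (to (R⇔ x) Rx)) 1+n≢0) , id ]′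

    -- A c.e. set disjoint from `A∪R` is almost contained in `R` and yet misses it, so it is finite
    -- and `∅` generates.
    leastFo-A∪R : ∀ B → B ≡m A∪R → A∪R ≤fo B
    leastFo-A∪R = Residue.≡m⇒≤fo (ce-∪ Rc ceA) ce-∅ A∪R-noncomputable (λ x ()) gen
      (λ P Pc → [ inj₁ ∘ weaken , inj₂ ∘ weaken ]′ (residue-cohesive dmax (generated G) P Pc))
      (inj₁ λ x ())
      where
      gen : ∀ D → CE D → Disjoint D A∪R → D ⊆* ∅
      gen D ceD disj with generated G D ceD (λ x Dx Ax → disj x Dx (inj₂ Ax))
      ... | n , D⊆R = n , λ x n≤x Dx → disj x Dx (inj₁ (D⊆R x n≤x Dx))
      weaken : (λ x → ¬ A x × ¬ R x) ⊆* P → (λ x → ¬ A∪R x × ¬ ⊥) ⊆* P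
      weaken (n , N⊆P) = n , λ x n≤x (¬A∪R , _) → N⊆P x n≤x (¬A∪R ∘ inj₂ , ¬A∪R ∘ inj₁)

-- The three types combined

theorem4p6 : ExcludedMiddle 0ℓ →
    (A : Set') → DMaximal A →
    (Type1 A ⊎ Type2 A ⊎ Type3 A) →
    Σ Set' (λ C → (C ≡m A) × ((B : Set') → B ≡m A → C ≤fo B))
theorem4p6 em A dmax (inj₁ gen∅) =
  A , (≤m-refl , ≤m-refl) , leastFo dmax gen∅ (inj₁ λ x ())
  where open Classical em
theorem4p6 em A dmax (inj₂ (inj₁ ((R , Rc , _ , genR) , _))) =
  C , C≡mA , λ B (B≤A , A≤B) →
    leastFo-A∪R dmax Rc genR B (≤m-trans B A C B≤A (proj₂ C≡mA) , ≤m-trans C A B (proj₁ C≡mA) A≤B)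
  where
  open Classical em
  C : Set'
  C = A∪R dmax Rc genR
  C≡mA : C ≡m A
  C≡mA = A∪R≡mA dmax Rc genR
theorem4p6 em A dmax (inj₂ (inj₂ ((W , _ , ¬Wc , _ , genW) , _))) =
  A , (≤m-refl , ≤m-refl) , leastFo dmax genW (inj₂ ¬Wc)
  where open Classical em
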